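{- Let $G$ be a finite simple bipartite graph with bipartition $(A,B)$, $|A|=|B|=n$, and suppose $G$ is pseudo $2$--factor isomorphic. Then $G$ has a vertex of degree at most $\lfloor \log_2 n \rfloor + 2$.
   Context: A $2$--factor of a graph is a spanning $2$--regular subgraph (a spanning collection of vertex-disjoint cycles). A graph $G$ is pseudo $2$--factor isomorphic if $G$ has at least one $2$--factor and the parity of the number of cycles in a $2$--factor is the same for all $2$--factors of $G$. -}

module Defs where

open import Data.Nat using (ℕ; _%_)
open import Data.Bool using (Bool; true; false; if_then_else_)
open import Data.Fin using (Fin)
open import Data.List using (List; map; allFin)
open import Data.Nat.ListAction using (sum)
open import Data.Sum using (_⊎_; inj₁; inj₂)
open import Data.Empty using (⊥)
open import Data.Product using (Σ; _×_; ∃)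
open import Function using (_⇔_)
open import Relation.Binary.PropositionalEquality using (_≡_)
open import Relation.Binary.Construct.Closure.ReflexiveTransitive using (Star)

-- A finite simple bipartite graph with bipartition (A , B), |A| = |B| = n.
-- A = inj₁ side, B = inj₂ side; the graph is given by its edge set ⊆ A × B.
BipGraph : ℕ → Set
BipGraph n = Fin n → Fin n → Bool

Vertex : ℕ → Set
Vertex n = Fin n ⊎ Fin n

countTrue : List Bool → ℕ
countTrue bs = sum (map (λ b → if b then 1 else 0) bs)

degree : ∀ {n} → BipGraph n → Vertex n → ℕ
degree {n} G (inj₁ a) = countTrue (map (λ b → G a b) (allFin n))
degree {n} G (inj₂ b) = countTrue (map (λ a → G a b) (allFin n))

SubgraphOf : ∀ {n} → BipGraph n → BipGraph n → Set
SubgraphOf {n} F G = (a b : Fin n) → F a b ≡ true → G a b ≡ true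

IsTwoFactor : ∀ {n} → BipGraph n → BipGraph n → Set
IsTwoFactor {n} G F = SubgraphOf F G × ((v : Vertex n) → degree F v ≡ 2)

Adj : ∀ {n} → BipGraph n → Vertex n → Vertex n → Set
Adj F (inj₁ a) (inj₂ b) = F a b ≡ true
Adj F (inj₂ b) (inj₁ a) = F a b ≡ true
Adj F (inj₁ _) (inj₁ _) = ⊥
Adj F (inj₂ _) (inj₂ _) = ⊥

Reachable : ∀ {n} → BipGraph n → Vertex n → Vertex n → Set
Reachable F = Star (Adj F)

-- F has exactly c connected components: there is a surjective labelling of
-- the vertices by Fin c whose fibres are exactly the connected components.
-- For a 2-factor, components are exactly its cycles.
HasComponentCount : ∀ {n} → BipGraph n → ℕ → Set
HasComponentCount {n} F c =
  Σ (Vertex n → Fin c) λ label →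
    ((i : Fin c) → ∃ λ v → label v ≡ i) ×
    ((u v : Vertex n) → (label u ≡ label v) ⇔ Reachable F u v)

Pseudo2FactorIsomorphic : ∀ {n} → BipGraph n → Set
Pseudo2FactorIsomorphic {n} G =
  (∃ λ F → IsTwoFactor G F) ×
  ((F₁ F₂ : BipGraph n) → IsTwoFactor G F₁ → IsTwoFactor G F₂ →
   (c₁ c₂ : ℕ) → HasComponentCount F₁ c₁ → HasComponentCount F₂ c₂ →
   c₁ % 2 ≡ c₂ % 2)

{-# OPTIONS --safe #-}

-- Suppose every vertex of A has degree at least d + 2, where n < 2 ^ d. Split a
-- 2-factor into perfect matchings σ and τ. A uniformly random 2-colouring of B
-- leaves some N(a) ∖ {σ a} monochromatic with probability at most n 2⁻ᵈ < 1, so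
-- for some colouring every a has a neighbour τ (f a) other than σ a coloured
-- differently from τ a. Colours alternate along the cycles of f, so these have
-- even length. Switching τ along one of them multiplies σ⁻¹ ∘ τ by a cycle of
-- even length, that is by an odd number of transpositions, each of which changes
-- the number of orbits by one: the 2-factor obtained has the other parity.
module Submission where

open import Defs
open import Data.Nat using (ℕ; _+_; _≤_; NonZero)
open import Data.Nat.Logarithm using (⌊log₂_⌋)
open import Data.Product using (∃)

open import Data.Bool using (Bool; true; false; not; _∨_; _∧_; _xor_; if_then_else_)
open import Data.Bool.Properties using (∧-identityʳ; ∨-zeroʳ; not-¬; not-involutive)
open import Data.Fin using (Fin; zero; suc; toℕ; fromℕ<; punchIn; punchOut)
open import Data.Fin.Permutation.Components using (transpose; transpose-inverse)
open import Data.Fin.Properties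
  using (_≟_; any?; pigeonhole; injective⇒≤; suc-injective;
         punchOut-cong; punchOut-injective; punchOut-punchIn; punchInᵢ≢i)
open import Data.List using (map; tabulate; allFin)
open import Data.List.Properties using (map-tabulate; tabulate-cong)
open import Data.Nat as ℕ
  using (zero; suc; _*_; _∸_; _<_; _<?_; _≤?_; s≤s; _^_; _%_; _/_; >-nonZero⁻¹)
open import Data.Nat.DivMod using (m≡m%n+[m/n]*n; m%n<n)
open import Data.Nat.GeneralisedArithmetic using (fold; fold-+)
open import Data.Nat.Induction using (<-rec)
open import Data.Nat.Logarithm using (⌊log₂⌋-mono-≤; ⌊log₂[2^n]⌋≡n)
import Data.Nat.Properties as ℕ
open import Data.Nat.Properties hiding (suc-injective; _≟_; _<?_; _≤?_)
open import Data.Nat.Tactic.RingSolver using (solve-∀)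
open import Data.Product using (Σ; ∃₂; _×_; _,_; proj₁; proj₂)
open import Data.Sum as Sum using (_⊎_; inj₁; inj₂)
open import Data.Vec using (Vec; []; _∷_; lookup)
open import Function using (_∘_; id; _⇔_; mk⇔; Equivalence; Injective)
open import Level using (0ℓ)
open import Relation.Binary using (Rel; Decidable; IsEquivalence; Reflexive; Symmetric; Transitive)
open import Relation.Binary.Construct.Closure.ReflexiveTransitive using (ε; _◅_; _◅◅_)
open import Relation.Binary.PropositionalEquality
open import Relation.Nullary using (¬_; yes; no; contradiction; does)
open import Relation.Nullary.Decidable using (map′; dec-true; dec-false)
open import Algebra.Properties.CommutativeMonoid.Sum +-0-commutativeMonoid using (sum)

private variable
  m n c c′ d : ℕ
  V W : Set

-- Counting the classes of an equivalence relation.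

-- `HasComponentCount F c` is the instance for `Reachable F`. The general form lets components of a
-- 2-factor be compared with orbits of a permutation.
ClassCount : Rel V 0ℓ → ℕ → Set
ClassCount {V} _~_ c =
  Σ (V → Fin c) λ label →
    ((i : Fin c) → ∃ λ v → label v ≡ i) ×
    ((u v : V) → (label u ≡ label v) ⇔ u ~ v)

module _ {_~_ : Rel V 0ℓ} where

  -- Relabelling one representative of each class by `label′` is injective, since both labellings
  -- have the same fibres.
  classCount-≤ : ClassCount _~_ c → ClassCount _~_ c′ → c ≤ c′
  classCount-≤ (_ , rep , rel) (label′ , _ , rel′) =
    injective⇒≤ {f = label′ ∘ proj₁ ∘ rep} λ {i} {j} eq →
      trans (sym (proj₂ (rep i)))
        (trans (Equivalence.from (rel _ _) (Equivalence.to (rel′ _ _) eq)) (proj₂ (rep j)))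

  classCount-unique : ClassCount _~_ c → ClassCount _~_ c′ → c ≡ c′
  classCount-unique k k′ = ≤-antisym (classCount-≤ k k′) (classCount-≤ k′ k)

  classCount-resp : {_≈_ : Rel W 0ℓ} (g : W → V) → (∀ v → ∃ λ w → g w ≡ v) →
    (∀ u w → g u ~ g w ⇔ u ≈ w) → ClassCount _~_ c → ClassCount _≈_ c
  classCount-resp g onto g-rel (label , rep , rel) =
    label ∘ g ,
    (λ i → let v , eq = rep i ; w , eq′ = onto v in w , trans (cong label eq′) eq) ,
    λ u w → mk⇔ (Equivalence.to (g-rel u w) ∘ Equivalence.to (rel _ _))
                (Equivalence.from (rel _ _) ∘ Equivalence.from (g-rel u w))

-- Induction on `n`: the element 0 takes the label of a later element related to it, or a fresh
-- label if there is none.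
classCount-exists : {_~_ : Rel (Fin n) 0ℓ} → IsEquivalence _~_ → Decidable _~_ → ∃ (ClassCount _~_)
classCount-exists {zero}  equiv _~?_ = 0 , (λ ()) , (λ ()) , λ ()
classCount-exists {suc n} {_~_} equiv _~?_
  with classCount-exists {_~_ = λ x y → suc x ~ suc y}
         (record { refl = E.refl ; sym = E.sym ; trans = E.trans }) (λ x y → suc x ~? suc y)
     | any? (λ x → zero ~? suc x)
  where module E = IsEquivalence equiv
... | c , label , rep , rel | yes (x , 0~x) = c , label′ , rep′ , rel′
  where
  module E = IsEquivalence equiv
  label′ : Fin (suc n) → Fin c
  label′ zero    = label x
  label′ (suc y) = label y
  rep′ : ∀ i → ∃ λ v → label′ v ≡ i
  rep′ i = suc (proj₁ (rep i)) , proj₂ (rep i)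
  rel′ : ∀ u v → (label′ u ≡ label′ v) ⇔ u ~ v
  rel′ zero    zero    = mk⇔ (λ _ → E.refl) (λ _ → refl)
  rel′ zero    (suc v) = mk⇔ (E.trans 0~x ∘ Equivalence.to (rel x v))
                             (Equivalence.from (rel x v) ∘ E.trans (E.sym 0~x))
  rel′ (suc u) zero    = mk⇔ (λ eq → E.trans (Equivalence.to (rel u x) eq) (E.sym 0~x))
                             (λ u~0 → Equivalence.from (rel u x) (E.trans u~0 0~x))
  rel′ (suc u) (suc v) = rel u v
... | c , label , rep , rel | no 0≁ = suc c , label′ , rep′ , rel′
  where
  module E = IsEquivalence equiv
  label′ : Fin (suc n) → Fin (suc c)
  label′ zero    = zero
  label′ (suc y) = suc (label y)
  rep′ : ∀ i → ∃ λ v → label′ v ≡ i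
  rep′ zero    = zero , refl
  rep′ (suc i) = suc (proj₁ (rep i)) , cong suc (proj₂ (rep i))
  rel′ : ∀ u v → (label′ u ≡ label′ v) ⇔ u ~ v
  rel′ zero    zero    = mk⇔ (λ _ → E.refl) (λ _ → refl)
  rel′ zero    (suc v) = mk⇔ (λ ()) (λ 0~v → contradiction (v , 0~v) 0≁)
  rel′ (suc u) zero    = mk⇔ (λ ()) (λ u~0 → contradiction (u , E.sym u~0) 0≁)
  rel′ (suc u) (suc v) = mk⇔ (Equivalence.to (rel u v) ∘ suc-injective)
                             (cong suc ∘ Equivalence.from (rel u v))

-- Identifying two points of a finite set.

module _ {p q : Fin (suc n)} (q≢p : q ≢ p) where

  -- The quotient map gluing `q` to `p`. It serves twice: to join two orbits, and to contract two
  -- neighbours of a vertex when a matching is built.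
  merge : Fin (suc n) → Fin n
  merge x with q ≟ x
  ... | yes _  = punchOut q≢p
  ... | no q≢x = punchOut q≢x

  merge-identifies : merge p ≡ merge q
  merge-identifies with q ≟ p | q ≟ q
  ... | yes q≡p | _       = contradiction q≡p q≢p
  ... | no  _   | no q≢q  = contradiction refl q≢q
  ... | no  _   | yes _   = punchOut-cong q refl

  merge-kernel : ∀ {x y} → merge x ≡ merge y →
    x ≡ y ⊎ (x ≡ p × y ≡ q) ⊎ (x ≡ q × y ≡ p)
  merge-kernel {x} {y} eq with q ≟ x | q ≟ y
  ... | yes q≡x | yes q≡y = inj₁ (trans (sym q≡x) q≡y)
  ... | yes q≡x | no  q≢y = inj₂ (inj₂ (sym q≡x , sym (punchOut-injective q≢p q≢y eq)))
  ... | no  q≢x | yes q≡y = inj₂ (inj₁ (punchOut-injective q≢x q≢p eq , sym q≡y))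
  ... | no  q≢x | no  q≢y = inj₁ (punchOut-injective q≢x q≢y eq)

  merge-punchIn : ∀ i → merge (punchIn q i) ≡ i
  merge-punchIn i with q ≟ punchIn q i
  ... | yes eq  = contradiction (sym eq) (punchInᵢ≢i q i)
  ... | no q≢x = trans (punchOut-cong q refl) (punchOut-punchIn q)

-- Transpositions.

transpose-left : (i j : Fin n) → transpose i j i ≡ j
transpose-left i j rewrite dec-true (i ≟ i) refl = refl

transpose-right : (i j : Fin n) → transpose i j j ≡ i
transpose-right i j with j ≟ i
... | yes j≡i = j≡i
... | no  _ rewrite dec-true (j ≟ j) refl = refl

transpose-other : (i j : Fin n) {k : Fin n} → k ≢ i → k ≢ j → transpose i j k ≡ k
transpose-other i j {k} k≢i k≢j
  rewrite dec-false (k ≟ i) k≢i | dec-false (k ≟ j) k≢j = refl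

either-or-neither : (P : Fin n → Set) (i j : Fin n) → P i → P j →
  (∀ {k} → k ≢ i → k ≢ j → P k) → ∀ k → P k
either-or-neither P i j Pi Pj P-other k with k ≟ i | k ≟ j
... | yes refl | _        = Pi
... | no _     | yes refl = Pj
... | no k≢i   | no k≢j   = P-other k≢i k≢j

transpose-comm : (i j k : Fin n) → transpose i j k ≡ transpose j i k
transpose-comm i j = either-or-neither (λ k → transpose i j k ≡ transpose j i k) i j
  (trans (transpose-left i j) (sym (transpose-right j i)))
  (trans (transpose-right i j) (sym (transpose-left j i)))
  (λ k≢i k≢j → trans (transpose-other i j k≢i k≢j) (sym (transpose-other j i k≢j k≢i)))

transpose-injective : (i j : Fin n) → Injective _≡_ _≡_ (transpose i j)
transpose-injective i j eq =
  trans (sym (transpose-inverse j i)) (trans (cong (transpose j i) eq) (transpose-inverse j i))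

-- Orbits of self-maps and permutations.

fold-sucʳ : ∀ (f : V → V) x k → fold (f x) f k ≡ f (fold x f k)
fold-sucʳ f x zero    = refl
fold-sucʳ f x (suc k) = cong f (fold-sucʳ f x k)

-- Forward iterates only; for an injective self-map of a finite set they already give an equivalence
-- relation.
Orbit : (V → V) → Rel V 0ℓ
Orbit π x y = ∃ λ k → fold x π k ≡ y

orbit-refl : {π : V → V} → Reflexive (Orbit π)
orbit-refl = 0 , refl

orbit-step : {π : V → V} (x : V) → Orbit π x (π x)
orbit-step x = 1 , refl

orbit-trans : {π : V → V} → Transitive (Orbit π)
orbit-trans {π = π} (k , refl) (l , eq) = l + k , trans (fold-+ _ π l) eq

-- The induction principle for orbits: a claim that is a preorder in the two endpoints need only be
-- checked on single steps of `π`.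
orbit-least : {π : V → V} {_~_ : Rel V 0ℓ} → Reflexive _~_ → Transitive _~_ →
  (∀ x → x ~ π x) → ∀ {x y} → Orbit π x y → x ~ y
orbit-least {_~_ = _~_} rfl trs step (zero , eq)  = subst (_ ~_) eq rfl
orbit-least {_~_ = _~_} rfl trs step (suc k , eq) =
  subst (_ ~_) eq (trs (orbit-least {_~_ = _~_} rfl trs step (k , refl)) (step _))

orbit-resp : {π ρ : V → V} → (∀ x → π x ≡ ρ x) → ∀ {x y} → Orbit π x y → Orbit ρ x y
orbit-resp {ρ = ρ} eq = orbit-least {_~_ = Orbit ρ} orbit-refl orbit-trans (λ x → 1 , sym (eq x))

eventually-periodic : (f : Fin n → Fin n) (x : Fin n) →
  ∃₂ λ i p → fold x f i ≡ fold x f (suc p + i)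
eventually-periodic {n} f x with pigeonhole (ℕ.n<1+n n) (λ i → fold x f (toℕ i))
-- The gap between the two equal iterates is positive; recording its predecessor keeps the period
-- visibly nonzero.
... | i , j , i<j , eq = toℕ i , toℕ j ∸ suc (toℕ i) ,
  trans eq (cong (fold x f) (sym (trans (sym (+-suc _ (toℕ i))) (m∸n+n≡m i<j))))

module Permutation {π : Fin n → Fin n} (inj : Injective _≡_ _≡_ π) where

  fold-injective : ∀ k {x y} → fold x π k ≡ fold y π k → x ≡ y
  fold-injective zero    eq = eq
  fold-injective (suc k) eq = fold-injective k (inj eq)

  -- Injectivity cancels the steps made before the periodic part is entered.
  periodic : ∀ x → ∃ λ p → fold x π (suc p) ≡ x
  periodic x with eventually-periodic π x
  ... | i , p , eq = p , fold-injective i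
    (trans (sym (fold-+ x π i)) (trans (cong (fold x π) (+-comm i (suc p))) (sym eq)))

  orbit-back : ∀ x → Orbit π (π x) x
  orbit-back x = let p , eq = periodic x in p , trans (fold-sucʳ π x p) eq

  surjective : ∀ y → ∃ λ x → π x ≡ y
  surjective y = let p , eq = periodic y in fold y π p , eq

  orbit-sym : Symmetric (Orbit π)
  orbit-sym = orbit-least {_~_ = λ x y → Orbit π y x} orbit-refl
    (λ s t → orbit-trans t s) orbit-back

  orbit-isEquivalence : IsEquivalence (Orbit π)
  orbit-isEquivalence = record { refl = orbit-refl ; sym = orbit-sym ; trans = orbit-trans }

  fold-multiple : ∀ x p q → fold x π p ≡ x → fold x π (q * p) ≡ x
  fold-multiple x p zero    eq = refl
  fold-multiple x p (suc q) eq =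
    trans (fold-+ x π p) (trans (cong (λ z → fold z π p) (fold-multiple x p q eq)) eq)

  -- Exponents can be reduced modulo the period of `x`, so finitely many have to be tested.
  orbit? : Decidable (Orbit π)
  orbit? x y with periodic x
  ... | p , eq = map′ (λ (k , _ , e) → k , e) bound (anyUpTo? (λ k → fold x π k ≟ y) (suc p))
    where
    bound : Orbit π x y → ∃ λ k → k < suc p × fold x π k ≡ y
    bound (k , e) = k % suc p , m%n<n k (suc p) ,
      trans (cong (λ z → fold z π (k % suc p)) (sym (fold-multiple x (suc p) (k / suc p) eq)))
        (trans (sym (fold-+ x π (k % suc p)))
          (trans (cong (fold x π) (sym (m≡m%n+[m/n]*n k (suc p)))) e))

  orbitCount : ∃ (ClassCount (Orbit π))
  orbitCount = classCount-exists orbit-isEquivalence orbit?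

-- Effect of a transposition on the number of orbits.

module Transposed {π : Fin n → Fin n} (inj : Injective _≡_ _≡_ π) (i j : Fin n) where
  open Permutation inj

  π′ : Fin n → Fin n
  π′ = π ∘ transpose i j

  π′-injective : Injective _≡_ _≡_ π′
  π′-injective eq = transpose-injective i j (inj eq)

  module P′ = Permutation π′-injective

  π′-i : π′ i ≡ π j
  π′-i = cong π (transpose-left i j)

  π′-j : π′ j ≡ π i
  π′-j = cong π (transpose-right i j)

  π′-other : ∀ {x} → x ≢ i → x ≢ j → π′ x ≡ π x
  π′-other x≢i x≢j = cong π (transpose-other i j x≢i x≢j)

  -- From i, π′ runs through the π-orbit of j until it reaches j.
  merges : ¬ Orbit π i j → Orbit π′ i j
  merges i≁j = let k , eq = orbit-back j in orbit-trans (1 , π′-i) (walk k eq)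
    where
    walk : ∀ k {z} → fold z π k ≡ j → Orbit π′ z j
    walk zero    eq = 0 , eq
    walk (suc k) {z} eq with z ≟ j
    ... | yes z≡j = 0 , z≡j
    ... | no  z≢j = orbit-trans (1 , π′-other z≢i z≢j) (walk k (trans (fold-sucʳ π z k) eq))
      where
      z≢i : z ≢ i
      z≢i refl = i≁j (suc k , eq)

  -- `Arc` contains `j` and is closed under `π′`, but it misses `i`.
  splits : i ≢ j → Orbit π i j → ¬ Orbit π′ i j
  splits i≢j (k , i→j) i~′j = i∉Arc (closed (P′.orbit-sym i~′j) here)
    where
    -- The stretch of the π-orbit from π i to j, which π′ closes up into an orbit.
    data Arc : Fin n → Set where
      here : Arc j
      step : ∀ {z} → z ≢ i → Arc (π z) → Arc z
    i∉Arc : ¬ Arc i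
    i∉Arc here          = i≢j refl
    i∉Arc (step i≢i _)  = i≢i refl
    -- Either `i` is not met between `z` and `j`, or the stretch after its last visit is an arc
    -- starting at `π i`.
    search : ∀ k {z} → fold z π k ≡ j → Arc z ⊎ Arc (π i)
    search zero    refl = inj₁ here
    search (suc k) {z} eq with z ≟ i | search k {π z} (trans (fold-sucʳ π z k) eq)
    ... | _       | inj₂ arc = inj₂ arc
    ... | yes z≡i | inj₁ arc = inj₂ (subst (Arc ∘ π) z≡i arc)
    ... | no  z≢i | inj₁ arc = inj₁ (step z≢i arc)
    πi∈Arc : Arc (π i)
    πi∈Arc with search k i→j
    ... | inj₁ arc = contradiction arc i∉Arc
    ... | inj₂ arc = arc
    closed-step : ∀ {z} → Arc z → Arc (π′ z)
    closed-step here = subst Arc (sym π′-j) πi∈Arc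
    closed-step {z} (step z≢i arc) with z ≟ j
    ... | yes refl = subst Arc (sym π′-j) πi∈Arc
    ... | no  z≢j  = subst Arc (sym (π′-other z≢i z≢j)) arc
    closed : ∀ {x y} → Orbit π′ x y → Arc x → Arc y
    closed = orbit-least {_~_ = λ x y → Arc x → Arc y} id (λ f g → g ∘ f) (λ _ → closed-step)

  -- The orbits of `i` and `j` become one and all others stay the same, so gluing these two labels
  -- gives a labelling for `π′`.
  mergedCount : ¬ Orbit π i j → ClassCount (Orbit π) (suc c) → ClassCount (Orbit π′) c
  mergedCount {c = c} i≁j (label , rep , rel) = label′ , rep′ , λ u v → mk⇔ connect invariant
    where
    j≢i : label j ≢ label i
    j≢i eq = i≁j (Equivalence.to (rel i j) (sym eq))
    label′ : Fin n → Fin c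
    label′ = merge j≢i ∘ label
    rep′ : ∀ l → ∃ λ v → label′ v ≡ l
    rep′ l = let v , eq = rep (punchIn (label j) l) in
      v , trans (cong (merge j≢i) eq) (merge-punchIn j≢i l)
    label-step : ∀ x → label x ≡ label (π x)
    label-step x = Equivalence.from (rel _ _) (orbit-step x)
    label′-step : ∀ x → label′ x ≡ label′ (π′ x)
    label′-step = either-or-neither (λ x → label′ x ≡ label′ (π′ x)) i j
      (trans (merge-identifies j≢i)
        (cong (merge j≢i) (trans (label-step j) (cong label (sym π′-i)))))
      (trans (sym (merge-identifies j≢i))
        (cong (merge j≢i) (trans (label-step i) (cong label (sym π′-j)))))
      (λ x≢i x≢j →
        cong (merge j≢i) (trans (label-step _) (cong label (sym (π′-other x≢i x≢j)))))
    invariant : ∀ {u v} → Orbit π′ u v → label′ u ≡ label′ v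
    invariant = orbit-least {_~_ = λ u v → label′ u ≡ label′ v} refl trans label′-step
    i~′j : Orbit π′ i j
    i~′j = merges i≁j
    -- A step of `π` out of `i` is a step of `π′` out of `j`, and conversely. As `π′` joins `i` and
    -- `j`, every `π`-orbit lies within a `π′`-orbit.
    coarser-step : ∀ x → Orbit π′ x (π x)
    coarser-step = either-or-neither (λ x → Orbit π′ x (π x)) i j
      (orbit-trans i~′j (1 , π′-j))
      (orbit-trans (P′.orbit-sym i~′j) (1 , π′-i))
      (λ x≢i x≢j → 1 , π′-other x≢i x≢j)
    coarser : ∀ {u v} → label u ≡ label v → Orbit π′ u v
    coarser eq = orbit-least {_~_ = Orbit π′} orbit-refl orbit-trans coarser-step
      (Equivalence.to (rel _ _) eq)
    connect : ∀ {u v} → label′ u ≡ label′ v → Orbit π′ u v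
    connect eq with merge-kernel j≢i eq
    ... | inj₁ eq′               = coarser eq′
    ... | inj₂ (inj₁ (u~i , v~j)) = orbit-trans (coarser u~i) (orbit-trans i~′j (coarser (sym v~j)))
    ... | inj₂ (inj₂ (u~j , v~i)) =
      orbit-trans (coarser u~j) (orbit-trans (P′.orbit-sym i~′j) (coarser (sym v~i)))

  mergedCount-unique : ¬ Orbit π i j →
    ClassCount (Orbit π) c → ClassCount (Orbit π′) c′ → c ≡ suc c′
  mergedCount-unique {c = zero}  _   (label , _) _ = contradiction (label i) λ ()
  mergedCount-unique {c = suc c} i≁j count count′ =
    cong suc (classCount-unique (mergedCount i≁j count) count′)

-- Splitting is merging read backwards: if `i` and `j` share a `π`-orbit, they are separated in the
-- product, and transposing once more joins them and restores `π`.
transposedCount : {π : Fin n → Fin n} → Injective _≡_ _≡_ π → {i j : Fin n} → i ≢ j →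
  ClassCount (Orbit π) c → ClassCount (Orbit (π ∘ transpose i j)) c′ → c ≡ suc c′ ⊎ c′ ≡ suc c
transposedCount {π = π} inj {i} {j} i≢j count count′ with Permutation.orbit? inj i j
... | no  i≁j = inj₁ (Transposed.mergedCount-unique inj i j i≁j count count′)
... | yes i~j = inj₂ (Transposed.mergedCount-unique (Transposed.π′-injective inj i j) i j
        (Transposed.splits inj i j i≢j i~j) count′
        (classCount-resp id (λ v → v , refl)
          (λ u v → mk⇔ (orbit-resp (λ x → sym (twice x))) (orbit-resp twice)) count))
  where
  twice : ∀ x → π (transpose i j (transpose i j x)) ≡ π x
  twice x = cong π (trans (transpose-comm i j (transpose i j x)) (transpose-inverse j i {x}))

-- Perfect matchings in 2-regular bipartite multigraphs.

-- A multigraph between A and B that is 2-regular on A is encoded by a map h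
-- sending the half-edges (a , s), s : Bool, to their ends in B.
AtMostTwice : {E B : Set} → (E → B) → Set
AtMostTwice h = ∀ e₁ e₂ e₃ → h e₁ ≡ h e₂ → h e₁ ≡ h e₃ → e₁ ≡ e₂ ⊎ e₁ ≡ e₃ ⊎ e₂ ≡ e₃

module _ (h : Fin (suc n) × Bool → Fin (suc n)) (twice : AtMostTwice h) where
  private
    lift : Fin n × Bool → Fin (suc n) × Bool
    lift (a , s) = suc a , s

    lift-injective : ∀ {e e′} → lift e ≡ lift e′ → e ≡ e′
    lift-injective refl = refl

  module Parallel (eq : h (zero , false) ≡ h (zero , true)) where
    -- The two half-edges at vertex 0 already exhaust their common end.
    avoids : ∀ e → h (zero , false) ≢ h (lift e)
    avoids e eq′ with twice (zero , false) (zero , true) (lift e) eq eq′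
    ... | inj₁ ()
    ... | inj₂ (inj₁ ())
    ... | inj₂ (inj₂ ())

    delete : Fin n × Bool → Fin n
    delete e = punchOut (avoids e)

    delete-twice : AtMostTwice delete
    delete-twice e₁ e₂ e₃ e₁~e₂ e₁~e₃ =
      Sum.map lift-injective (Sum.map lift-injective lift-injective)
        (twice (lift e₁) (lift e₂) (lift e₃) (undelete e₁ e₂ e₁~e₂) (undelete e₁ e₃ e₁~e₃))
      where
      undelete : ∀ e e′ → delete e ≡ delete e′ → h (lift e) ≡ h (lift e′)
      undelete e e′ = punchOut-injective (avoids e) (avoids e′)

    extend : (s : Fin n → Bool) → Injective _≡_ _≡_ (λ a → delete (a , s a)) →
      ∃ λ (s : Fin (suc n) → Bool) → Injective _≡_ _≡_ (λ a → h (a , s a))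
    extend s inj = s′ , inj′ _ _
      where
      s′ : Fin (suc n) → Bool
      s′ zero    = false
      s′ (suc a) = s a
      inj′ : ∀ a a′ → h (a , s′ a) ≡ h (a′ , s′ a′) → a ≡ a′
      inj′ zero    zero     eq = refl
      inj′ zero    (suc a′) eq = contradiction eq (avoids (a′ , s a′))
      inj′ (suc a) zero     eq = contradiction (sym eq) (avoids (a , s a))
      inj′ (suc a) (suc a′) eq = cong suc (inj (punchOut-cong (h (zero , false)) eq))

  module Distinct (q≢p : h (zero , true) ≢ h (zero , false)) where
    contract : Fin n × Bool → Fin n
    contract e = merge q≢p (h (lift e))

    unique : ∀ b e e′ → h (lift e) ≡ h (zero , b) → h (lift e′) ≡ h (zero , b) → e ≡ e′
    unique b e e′ eq eq′ with twice (lift e) (lift e′) (zero , b) (trans eq (sym eq′)) eq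
    ... | inj₁ e≡e′      = lift-injective e≡e′
    ... | inj₂ (inj₁ ())
    ... | inj₂ (inj₂ ())

    -- Each of the two glued ends loses a half-edge to the deleted vertex, so by `unique` it keeps
    -- at most one, and the glued point gets at most two.
    contract-twice : AtMostTwice contract
    contract-twice e₁ e₂ e₃ e₁~e₂ e₁~e₃
      with merge-kernel q≢p e₁~e₂ | merge-kernel q≢p e₁~e₃
    ... | inj₁ eq | inj₁ eq′ =
      Sum.map lift-injective (Sum.map lift-injective lift-injective)
        (twice (lift e₁) (lift e₂) (lift e₃) eq eq′)
    ... | inj₁ eq | inj₂ (inj₁ (at-p , _)) = inj₁ (unique false e₁ e₂ at-p (trans (sym eq) at-p))
    ... | inj₁ eq | inj₂ (inj₂ (at-q , _)) = inj₁ (unique true e₁ e₂ at-q (trans (sym eq) at-q))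
    ... | inj₂ (inj₁ (at-p , _)) | inj₁ eq = inj₂ (inj₁ (unique false e₁ e₃ at-p (trans (sym eq) at-p)))
    ... | inj₂ (inj₂ (at-q , _)) | inj₁ eq = inj₂ (inj₁ (unique true e₁ e₃ at-q (trans (sym eq) at-q)))
    ... | inj₂ (inj₁ (_ , at-q)) | inj₂ (inj₁ (_ , at-q′)) = inj₂ (inj₂ (unique true e₂ e₃ at-q at-q′))
    ... | inj₂ (inj₂ (_ , at-p)) | inj₂ (inj₂ (_ , at-p′)) = inj₂ (inj₂ (unique false e₂ e₃ at-p at-p′))
    ... | inj₂ (inj₁ (at-p , _)) | inj₂ (inj₂ (at-q , _)) = contradiction (trans (sym at-q) at-p) q≢p
    ... | inj₂ (inj₂ (at-q , _)) | inj₂ (inj₁ (at-p , _)) = contradiction (trans (sym at-q) at-p) q≢p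

    extend : (s : Fin n → Bool) → Injective _≡_ _≡_ (λ a → contract (a , s a)) →
      ∃ λ (s : Fin (suc n) → Bool) → Injective _≡_ _≡_ (λ a → h (a , s a))
    extend s inj with any? (λ a → h (suc a , s a) ≟ h (zero , false))
    ... | yes (a₀ , at-p) = s′ , inj′ _ _
      where
      s′ : Fin (suc n) → Bool
      s′ zero    = true
      s′ (suc a) = s a
      -- A vertex matched to the other end would collide with `a₀` at the contracted point.
      avoids : ∀ a → h (suc a , s a) ≢ h (zero , true)
      avoids a at-q with inj {a} {a₀} (trans (cong (merge q≢p) at-q)
                           (trans (sym (merge-identifies q≢p)) (cong (merge q≢p) (sym at-p))))
      ... | refl = q≢p (trans (sym at-q) at-p)
      inj′ : ∀ a a′ → h (a , s′ a) ≡ h (a′ , s′ a′) → a ≡ a′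
      inj′ zero    zero     eq = refl
      inj′ zero    (suc a′) eq = contradiction (sym eq) (avoids a′)
      inj′ (suc a) zero     eq = contradiction eq (avoids a)
      inj′ (suc a) (suc a′) eq = cong suc (inj (cong (merge q≢p) eq))
    ... | no avoids = s′ , inj′ _ _
      where
      s′ : Fin (suc n) → Bool
      s′ zero    = false
      s′ (suc a) = s a
      inj′ : ∀ a a′ → h (a , s′ a) ≡ h (a′ , s′ a′) → a ≡ a′
      inj′ zero    zero     eq = refl
      inj′ zero    (suc a′) eq = contradiction (a′ , sym eq) avoids
      inj′ (suc a) zero     eq = contradiction (a , eq) avoids
      inj′ (suc a) (suc a′) eq = cong suc (inj (cong (merge q≢p) eq))

-- Delete the vertex 0 and identify its two neighbours (drop its neighbour if
-- they coincide): a matching of the smaller multigraph uses at most one of the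
-- two, so the other is free for 0.
perfectMatching : (h : Fin n × Bool → Fin n) → AtMostTwice h →
  ∃ λ (s : Fin n → Bool) → Injective _≡_ _≡_ (λ a → h (a , s a))
perfectMatching {zero}  h twice = (λ ()) , λ {}
perfectMatching {suc n} h twice with h (zero , true) ≟ h (zero , false)
... | yes q≡p = let open Parallel h twice (sym q≡p)
                    s , inj = perfectMatching delete delete-twice
                in extend s inj
... | no  q≢p = let open Distinct h twice q≢p
                    s , inj = perfectMatching contract contract-twice
                in extend s inj

-- Counting the elements of a decidable subset.

count : (Fin n → Bool) → ℕ
count P = countTrue (tabulate P)

countTrue-allFin : (P : Fin n → Bool) → countTrue (map P (allFin n)) ≡ count P
countTrue-allFin P = cong countTrue (map-tabulate id P)

count-cong : {P Q : Fin n → Bool} → (∀ k → P k ≡ Q k) → count P ≡ count Q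
count-cong eq = cong countTrue (tabulate-cong eq)

erase : Fin n → (Fin n → Bool) → Fin n → Bool
erase i P k = P k ∧ not (does (k ≟ i))

count-erase : (P : Fin n → Bool) (i : Fin n) → P i ≡ true → count P ≡ suc (count (erase i P))
count-erase P zero    Pi rewrite Pi = cong suc (count-cong (λ k → sym (∧-identityʳ (P (suc k)))))
count-erase P (suc i) Pi rewrite ∧-identityʳ (P zero) =
  trans (cong ((if P zero then 1 else 0) +_) (count-erase (P ∘ suc) i Pi))
    (+-suc (if P zero then 1 else 0) (count (erase i (P ∘ suc))))

erase-true : (P : Fin n → Bool) (i : Fin n) {k : Fin n} → erase i P k ≡ true → P k ≡ true × k ≢ i
erase-true P i {k} eq with P k | k ≟ i
erase-true P i refl | true | no k≢i = refl , k≢i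

erase-keeps : (P : Fin n → Bool) (i : Fin n) {k : Fin n} → P k ≡ true → k ≢ i → erase i P k ≡ true
erase-keeps P i {k} Pk k≢i rewrite Pk | dec-false (k ≟ i) k≢i = refl

count-witness : (P : Fin n → Bool) → count P ≡ suc m → ∃ λ k → P k ≡ true
count-witness {n = suc n} P eq with P zero in P0
... | true  = zero , P0
... | false = let k , Pk = count-witness (P ∘ suc) eq in suc k , Pk

count-none : (P : Fin n → Bool) → (∀ k → P k ≢ true) → count P ≡ 0
count-none P none with count P in eq
... | zero  = refl
... | suc _ = let k , Pk = count-witness P eq in contradiction Pk (none k)

count≡2⇒pair : (P : Fin n → Bool) → count P ≡ 2 →
  ∃₂ λ i j → i ≢ j × P i ≡ true × P j ≡ true × (∀ k → P k ≡ true → k ≡ i ⊎ k ≡ j)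
count≡2⇒pair P eq
  with i , Pi ← count-witness P eq
  with eq₁ ← ℕ.suc-injective (trans (sym (count-erase P i Pi)) eq)
  with j , P₁j ← count-witness (erase i P) eq₁
  with Pj , j≢i ← erase-true P i P₁j
  with eq₂ ← ℕ.suc-injective (trans (sym (count-erase (erase i P) j P₁j)) eq₁)
  = i , j , j≢i ∘ sym , Pi , Pj , only
  where
  only : ∀ k → P k ≡ true → k ≡ i ⊎ k ≡ j
  only k Pk with k ≟ i | k ≟ j
  ... | yes k≡i | _       = inj₁ k≡i
  ... | no _    | yes k≡j = inj₂ k≡j
  ... | no k≢i  | no k≢j  = contradiction
    (trans (sym eq₂) (count-erase (erase j (erase i P)) k
      (erase-keeps (erase i P) j (erase-keeps P i Pk k≢i) k≢j))) λ ()

pair⇒count≡2 : (P : Fin n → Bool) {i j : Fin n} → i ≢ j → P i ≡ true → P j ≡ true →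
  (∀ k → P k ≡ true → k ≡ i ⊎ k ≡ j) → count P ≡ 2
pair⇒count≡2 P {i} {j} i≢j Pi Pj only = trans (count-erase P i Pi)
  (cong suc (trans (count-erase (erase i P) j (erase-keeps P i Pj (i≢j ∘ sym)))
    (cong suc (count-none (erase j (erase i P)) none))))
  where
  none : ∀ k → erase j (erase i P) k ≢ true
  none k eq with erase-true (erase i P) j eq
  ... | eq′ , k≢j with erase-true P i eq′
  ... | Pk , k≢i with only k Pk
  ... | inj₁ k≡i = k≢i k≡i
  ... | inj₂ k≡j = k≢j k≡j

-- A two-colouring by averaging.

-- This is 2 ^ n times the expectation of `Φ` under a uniformly random colouring; using totals keeps
-- the argument in ℕ.
total : (Vec Bool n → ℕ) → ℕ
total {zero}  Φ = Φ []
total {suc n} Φ = total (Φ ∘ (true ∷_)) + total (Φ ∘ (false ∷_))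

total-0 : ∀ n → total {n} (λ _ → 0) ≡ 0
total-0 zero    = refl
total-0 (suc n) = cong₂ _+_ (total-0 n) (total-0 n)

total-+ : (Φ Ψ : Vec Bool n → ℕ) → total (λ v → Φ v + Ψ v) ≡ total Φ + total Ψ
total-+ {zero}  Φ Ψ = refl
total-+ {suc n} Φ Ψ = trans
  (cong₂ _+_ (total-+ (Φ ∘ (true ∷_)) (Ψ ∘ (true ∷_))) (total-+ (Φ ∘ (false ∷_)) (Ψ ∘ (false ∷_))))
  (interchange (total (Φ ∘ (true ∷_))) _ _ _)
  where
  interchange : ∀ a b c d → (a + b) + (c + d) ≡ (a + c) + (b + d)
  interchange = solve-∀

-- Linearity of expectation, with the denominator `K` of the bound on each term cleared.
total-sum-≤ : ∀ {K B} (Φ : Fin m → Vec Bool n → ℕ) → (∀ i → total (Φ i) * K ≤ B) →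
  total (λ v → sum (λ i → Φ i v)) * K ≤ m * B
total-sum-≤ {m = zero} {n} {K} Φ bound = ≤-reflexive (cong (_* K) (total-0 n))
total-sum-≤ {m = suc m} {n} {K} Φ bound = ≤-trans
  (≤-reflexive (trans (cong (_* K) (total-+ (Φ zero) _)) (*-distribʳ-+ K (total (Φ zero)) _)))
  (+-mono-≤ (bound zero) (total-sum-≤ (Φ ∘ suc) (bound ∘ suc)))

-- An average below 1 forces the value 0 somewhere. Colours are fixed one at a time: of the two
-- halves of the total, one stays below half the bound.
total-average : (Φ : Vec Bool n → ℕ) → total Φ < 2 ^ n → ∃ λ v → Φ v ≡ 0
total-average {zero}  Φ (s≤s Φ≤0) = [] , n≤0⇒n≡0 Φ≤0
total-average {suc n} Φ lt with total (Φ ∘ (true ∷_)) <? 2 ^ n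
... | yes lt′ = let v , eq = total-average _ lt′ in true ∷ v , eq
... | no  ≥   = let v , eq = total-average _ lt′ in false ∷ v , eq
  where
  lt′ : total (Φ ∘ (false ∷_)) < 2 ^ n
  lt′ = +-cancelˡ-< (2 ^ n) _ _ (≤-<-trans (+-monoˡ-≤ _ (≮⇒≥ ≥))
    (subst (λ z → total Φ < 2 ^ n + z) (+-identityʳ (2 ^ n)) lt))

sum≡0 : (f : Fin n → ℕ) → sum f ≡ 0 → ∀ i → f i ≡ 0
sum≡0 f eq zero    = m+n≡0⇒m≡0 (f zero) eq
sum≡0 f eq (suc i) = sum≡0 (f ∘ suc) (m+n≡0⇒n≡0 (f zero) eq) i

-- An indicator with values in ℕ, so that its `total` counts colourings.
monochromatic : Bool → (Fin n → Bool) → Vec Bool n → ℕ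
monochromatic c P []      = 1
monochromatic c P (x ∷ v) = if P zero ∧ (c xor x) then 0 else monochromatic c (P ∘ suc) v

-- Colours are forced on `P` and free elsewhere, two choices for each free element; multiplying out
-- avoids a subtraction in the exponent.
total-monochromatic : ∀ c (P : Fin n → Bool) → total (monochromatic c P) * 2 ^ count P ≡ 2 ^ n
total-monochromatic {zero}  c P = refl
total-monochromatic {suc n} c P with P zero | total-monochromatic c (P ∘ suc)
... | false | ih = trans (rearrange (total (monochromatic c (P ∘ suc))) (2 ^ count (P ∘ suc)))
      (cong (2 *_) ih)
  where
  rearrange : ∀ t k → (t + t) * k ≡ 2 * (t * k)
  rearrange = solve-∀
total-monochromatic {suc n} true P | true | ih rewrite total-0 n =
    trans (rearrange (total (monochromatic true (P ∘ suc))) (2 ^ count (P ∘ suc)))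
      (cong (2 *_) ih)
  where
  rearrange : ∀ t k → (t + 0) * (2 * k) ≡ 2 * (t * k)
  rearrange = solve-∀
total-monochromatic {suc n} false P | true | ih rewrite total-0 n =
    trans (rearrange (total (monochromatic false (P ∘ suc))) (2 ^ count (P ∘ suc)))
      (cong (2 *_) ih)
  where
  rearrange : ∀ t k → t * (2 * k) ≡ 2 * (t * k)
  rearrange = solve-∀

monochromatic≡0 : ∀ c (P : Fin n → Bool) v → monochromatic c P v ≡ 0 →
  ∃ λ k → P k ≡ true × lookup v k ≡ not c
monochromatic≡0 c P (x ∷ v) eq with P zero in P0 | c | x
... | true  | true  | false = zero , P0 , refl
... | true  | false | true  = zero , P0 , refl
... | false | c′    | _     = let k , Pk , vk = monochromatic≡0 c′ (P ∘ suc) v eq in suc k , Pk , vk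
... | true  | true  | true  = let k , Pk , vk = monochromatic≡0 true (P ∘ suc) v eq in suc k , Pk , vk
... | true  | false | false = let k , Pk , vk = monochromatic≡0 false (P ∘ suc) v eq in suc k , Pk , vk

-- Union bound: each set has at least d + 1 elements, so either colour fills it with probability at
-- most 2 ^ -(d + 1). Over both colours and all `m` sets this sums to at most m / 2 ^ d, which is
-- below 1.
twoColouring : (E : Fin m → Fin n → Bool) → (∀ i → suc d ≤ count (E i)) → m < 2 ^ d →
  ∃ λ (v : Vec Bool n) → ∀ i c → ∃ λ k → E i k ≡ true × lookup v k ≡ not c
twoColouring {m} {n} {d} E large m<2^d with total-average Φ few
  where
  cost : Fin m → Vec Bool n → ℕ
  cost i v = monochromatic true (E i) v + monochromatic false (E i) v
  Φ : Vec Bool n → ℕ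
  Φ v = sum (λ i → cost i v)
  halfBound : ∀ c i → total (monochromatic c (E i)) * (2 * 2 ^ d) ≤ 2 ^ n
  halfBound c i = ≤-trans (*-monoʳ-≤ (total (monochromatic c (E i))) (^-monoʳ-≤ 2 (large i)))
    (≤-reflexive (total-monochromatic c (E i)))
  regroup : ∀ s t k → 2 * ((s + t) * k) ≡ s * (2 * k) + t * (2 * k)
  regroup = solve-∀
  bound : ∀ i → total (cost i) * 2 ^ d ≤ 2 ^ n
  bound i = *-cancelˡ-≤ 2 (begin
    2 * (total (cost i) * 2 ^ d)
      ≡⟨ cong (λ t → 2 * (t * 2 ^ d)) (total-+ (monochromatic true (E i)) _) ⟩
    2 * ((total (monochromatic true (E i)) + total (monochromatic false (E i))) * 2 ^ d)
      ≡⟨ regroup (total (monochromatic true (E i))) _ (2 ^ d) ⟩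
    total (monochromatic true (E i)) * (2 * 2 ^ d) + total (monochromatic false (E i)) * (2 * 2 ^ d)
      ≤⟨ +-mono-≤ (halfBound true i) (halfBound false i) ⟩
    2 ^ n + 2 ^ n
      ≡⟨ cong (2 ^ n +_) (sym (+-identityʳ (2 ^ n))) ⟩
    2 * 2 ^ n ∎)
    where open ≤-Reasoning
  few : total Φ < 2 ^ n
  few = *-cancelʳ-< (2 ^ d) (total Φ) (2 ^ n) (≤-<-trans (total-sum-≤ cost bound)
    (subst (m * 2 ^ n <_) (*-comm (2 ^ d) (2 ^ n)) (*-monoˡ-< (2 ^ n) {{m^n≢0 2 n}} m<2^d)))
... | v , eq = v , found
  where
  found : ∀ i c → ∃ λ k → E i k ≡ true × lookup v k ≡ not c
  found i true  = monochromatic≡0 true (E i) v (m+n≡0⇒m≡0 _ (sum≡0 _ eq i))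
  found i false = monochromatic≡0 false (E i) v
    (m+n≡0⇒n≡0 (monochromatic true (E i) v) (sum≡0 _ eq i))

-- Simple cycles of a self-map, and parity.

leastPeriod : (f : Fin n → Fin n) (y : Fin n) (p : ℕ) → fold y f (suc p) ≡ y →
  ∃ λ q → fold y f (suc q) ≡ y × (∀ {r} → r < q → fold y f (suc r) ≢ y)
leastPeriod f y = <-rec Least descend
  where
  Least : ℕ → Set
  Least p = fold y f (suc p) ≡ y →
    ∃ λ q → fold y f (suc q) ≡ y × (∀ {r} → r < q → fold y f (suc r) ≢ y)
  descend : ∀ p → (∀ {q} → q < p → Least q) → Least p
  descend p rec eq with anyUpTo? (λ r → fold y f (suc r) ≟ y) p
  ... | yes (r , r<p , eq′) = rec r<p eq′
  ... | no  none            = p , eq , λ r<p eq′ → none (_ , r<p , eq′)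

-- As `f` may fail to be injective, the walk first enters its periodic part. There a coincidence at
-- times i < j would close the cycle j - i steps early, against minimality of the period.
simpleCycle : (f : Fin n → Fin n) → Fin n → ∃₂ λ y p →
  fold y f (suc p) ≡ y × (∀ {i j} → i < j → j ≤ p → fold y f i ≢ fold y f j)
simpleCycle f x with i₀ , p₀ , eq₀ ← eventually-periodic f x
  with p , eq , least ← leastPeriod f (fold x f i₀) p₀ (trans (sym (fold-+ x f (suc p₀))) (sym eq₀))
  = y , p , eq , distinct
  where
  y = fold x f i₀
  distinct : ∀ {i j} → i < j → j ≤ p → fold y f i ≢ fold y f j
  distinct {i} {j} i<j j≤p eq′ = least shorter (begin
    fold y f (suc (p ∸ j + i))           ≡⟨ fold-+ y f (suc (p ∸ j)) ⟩
    fold (fold y f i) f (suc (p ∸ j))    ≡⟨ cong (λ z → fold z f (suc (p ∸ j))) eq′ ⟩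
    fold (fold y f j) f (suc (p ∸ j))    ≡⟨ fold-+ y f (suc (p ∸ j)) ⟨
    fold y f (suc (p ∸ j + j))           ≡⟨ cong (fold y f ∘ suc) (m∸n+n≡m j≤p) ⟩
    fold y f (suc p)                     ≡⟨ eq ⟩
    y                                    ∎)
    where
    open ≡-Reasoning
    shorter : p ∸ j + i < p
    shorter = subst (p ∸ j + i <_) (m∸n+n≡m j≤p) (+-monoʳ-< (p ∸ j) i<j)

fold-not-even : ∀ b k → fold b not k ≡ b → k % 2 ≡ 0
fold-not-even b     zero          eq = refl
fold-not-even b     (suc zero)    eq = contradiction (sym eq) (not-¬ refl)
fold-not-even b     (suc (suc k)) eq =
  fold-not-even b k (trans (sym (not-involutive _)) eq)

fold-alternating : {f : Fin n → Fin n} (colour : Fin n → Bool) →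
  (∀ x → colour (f x) ≡ not (colour x)) → ∀ x k → colour (fold x f k) ≡ fold (colour x) not k
fold-alternating colour alt x zero    = refl
fold-alternating colour alt x (suc k) = trans (alt _) (cong not (fold-alternating colour alt x k))

suc-%2-≢ : ∀ k → suc k % 2 ≢ k % 2
suc-%2-≢ (suc (suc k)) eq = suc-%2-≢ k eq

-- In the application `suc k` is the length of the switched cycle and `k` the number of
-- transpositions composing it.
even+odd : ∀ c k → suc k % 2 ≡ 0 → (c + k) % 2 ≢ c % 2
even+odd c (suc zero)    _  eq = suc-%2-≢ c (trans (cong (_% 2) (sym (+-comm c 1))) eq)
even+odd c (suc (suc k)) even eq = even+odd c k even
  (trans (sym (cong (_% 2) (trans (+-suc c (suc k)) (cong suc (+-suc c k))))) eq)

-- Cyclic permutations as products of transpositions.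

module Rotation (x : ℕ → Fin n) where

  -- The cyclic permutation x 0 ↦ x 1 ↦ … ↦ x k ↦ x 0, when these are distinct.
  rotate : ℕ → Fin n → Fin n
  rotate zero    = id
  rotate (suc k) = rotate k ∘ transpose (x k) (x (suc k))

  rotate-injective : ∀ k → Injective _≡_ _≡_ (rotate k)
  rotate-injective zero    eq = eq
  rotate-injective (suc k) eq = transpose-injective (x k) (x (suc k)) (rotate-injective k eq)

  -- Each of the `k` transpositions flips the parity of the orbit count, by `transposedCount`. The
  -- induction works because `π ∘ rotate (suc k)` unfolds to `π ∘ rotate k` composed with one more
  -- transposition.
  rotate-count : {π : Fin n → Fin n} → Injective _≡_ _≡_ π → (∀ k → x k ≢ x (suc k)) →
    ∀ k {c c′} → ClassCount (Orbit π) c → ClassCount (Orbit (π ∘ rotate k)) c′ →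
    (c′ + k) % 2 ≡ c % 2
  rotate-count inj x≢ zero {c} count count′
    rewrite classCount-unique count′ count = cong (_% 2) (+-identityʳ c)
  rotate-count {π} inj x≢ (suc k) {c} {c′} count count′
    with inj-k ← (λ {a} {b} eq → rotate-injective k {a} {b} (inj eq))
    with c″ , count″ ← Permutation.orbitCount {π = π ∘ rotate k} inj-k
    with ih ← rotate-count inj x≢ k count count″
    with transposedCount inj-k (x≢ k) count″ count′
  ... | inj₁ refl = trans (cong (_% 2) (+-suc c′ k)) ih
  -- The two sides differ by 2, which `% 2` removes by computation.
  ... | inj₂ refl = trans (cong (λ z → suc z % 2) (+-suc c″ k)) ih

  module _ {p : ℕ} (distinct : ∀ {i j} → i < j → j ≤ p → x i ≢ x j) where

    rotate-fixes : ∀ k {y} → (∀ {i} → i ≤ k → y ≢ x i) → rotate k y ≡ y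
    rotate-fixes zero    off = refl
    rotate-fixes (suc k) off = trans
      (cong (rotate k) (transpose-other (x k) (x (suc k)) (off (n≤1+n k)) (off ≤-refl)))
      (rotate-fixes k (off ∘ m≤n⇒m≤1+n))

    rotate-last : ∀ k → k ≤ p → rotate k (x k) ≡ x 0
    rotate-last zero    _   = refl
    rotate-last (suc k) k<p = trans (cong (rotate k) (transpose-right (x k) (x (suc k))))
      (rotate-last k (<⇒≤ k<p))

    -- The transposition applied first either misses `x i`, or carries it to `x (suc i)`, which the
    -- remaining ones do not move.
    rotate-shift : ∀ k {i} → k ≤ p → i < k → rotate k (x i) ≡ x (suc i)
    rotate-shift (suc k) {i} k<p (s≤s i≤k) with m≤n⇒m<n∨m≡n i≤k
    ... | inj₂ refl = trans (cong (rotate k) (transpose-left (x k) (x (suc k))))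
      (rotate-fixes k (λ i≤k → distinct (s≤s i≤k) k<p ∘ sym))
    ... | inj₁ i<k = trans
      (cong (rotate k) (transpose-other (x k) (x (suc k))
        (distinct i<k (<⇒≤ k<p)) (distinct (s≤s i≤k) k<p)))
      (rotate-shift k (<⇒≤ k<p) i<k)

    -- `rotate p` is a permutation that follows `f` along one cycle and fixes all else, so a
    -- matching switched by it uses only edges known to lie in the graph.
    rotate-cycle : {f : Fin n → Fin n} → (∀ k → x (suc k) ≡ f (x k)) → x (suc p) ≡ x 0 →
      ∀ y → rotate p y ≡ y ⊎ rotate p y ≡ f y
    rotate-cycle {f} follows closes y with anyUpTo? (λ i → y ≟ x i) (suc p)
    ... | no off = inj₁ (rotate-fixes p (λ i≤p eq → off (_ , s≤s i≤p , eq)))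
    ... | yes (i , s≤s i≤p , refl) with m≤n⇒m<n∨m≡n i≤p
    ...   | inj₁ i<p  = inj₂ (trans (rotate-shift p ≤-refl i<p) (follows i))
    ...   | inj₂ refl = inj₂ (trans (rotate-last p ≤-refl) (trans (sym closes) (follows p)))

-- Unions of two perfect matchings and their components.

union : (σ τ : Fin n → Fin n) → BipGraph n
union σ τ a b = does (b ≟ σ a) ∨ does (b ≟ τ a)

module Union {σ τ : Fin n → Fin n} (σ-inj : Injective _≡_ _≡_ σ) (τ-inj : Injective _≡_ _≡_ τ) where
  private
    module σ = Permutation σ-inj
    module τ = Permutation τ-inj

  σ⁻¹ : Fin n → Fin n
  σ⁻¹ b = proj₁ (σ.surjective b)

  σσ⁻¹ : ∀ b → σ (σ⁻¹ b) ≡ b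
  σσ⁻¹ b = proj₂ (σ.surjective b)

  σ⁻¹-injective : Injective _≡_ _≡_ σ⁻¹
  σ⁻¹-injective {b} {b′} eq = trans (sym (σσ⁻¹ b)) (trans (cong σ eq) (σσ⁻¹ b′))

  -- Goes from A to B along a `τ`-edge and back along a `σ`-edge, so its orbits are the traces on A
  -- of the components of `union σ τ`.
  relative : Fin n → Fin n
  relative = σ⁻¹ ∘ τ

  relative-injective : Injective _≡_ _≡_ relative
  relative-injective eq = τ-inj (σ⁻¹-injective eq)

  private
    F : BipGraph n
    F = union σ τ

  union-left : ∀ {a b} → b ≡ σ a → F a b ≡ true
  union-left {a} {b} eq rewrite dec-true (b ≟ σ a) eq = refl

  union-right : ∀ {a b} → b ≡ τ a → F a b ≡ true
  union-right {a} {b} eq rewrite dec-true (b ≟ τ a) eq = ∨-zeroʳ _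

  union-true : ∀ a b → F a b ≡ true → b ≡ σ a ⊎ b ≡ τ a
  union-true a b eq with b ≟ σ a | b ≟ τ a
  ... | yes b≡σa | _        = inj₁ b≡σa
  ... | no _     | yes b≡τa = inj₂ b≡τa

  union-isTwoFactor : {G : BipGraph n} → (∀ a → G a (σ a) ≡ true) → (∀ a → G a (τ a) ≡ true) →
    (∀ a → σ a ≢ τ a) → IsTwoFactor G F
  union-isTwoFactor {G} Gσ Gτ σ≢τ = subgraph , regular
    where
    subgraph : SubgraphOf F G
    subgraph a b eq with union-true a b eq
    ... | inj₁ refl = Gσ a
    ... | inj₂ refl = Gτ a
    regular : ∀ v → degree F v ≡ 2
    regular (inj₁ a) = trans (countTrue-allFin (F a))
      (pair⇒count≡2 (F a) (σ≢τ a) (union-left refl) (union-right refl) (union-true a))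
    regular (inj₂ b) = trans (countTrue-allFin (λ a → F a b))
      (pair⇒count≡2 (λ a → F a b) distinct
        (union-left (sym (σσ⁻¹ b))) (union-right (sym (proj₂ (τ.surjective b)))) only)
      where
      τ⁻¹b = proj₁ (τ.surjective b)
      distinct : σ⁻¹ b ≢ τ⁻¹b
      distinct eq = σ≢τ (σ⁻¹ b) (trans (σσ⁻¹ b)
        (trans (sym (proj₂ (τ.surjective b))) (cong τ (sym eq))))
      only : ∀ a → F a b ≡ true → a ≡ σ⁻¹ b ⊎ a ≡ τ⁻¹b
      only a eq with union-true a b eq
      ... | inj₁ b≡σa = inj₁ (σ-inj (trans (sym b≡σa) (sym (σσ⁻¹ b))))
      ... | inj₂ b≡τa = inj₂ (τ-inj (trans (sym b≡τa) (sym (proj₂ (τ.surjective b)))))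

  private module R = Permutation relative-injective

  project : Vertex n → Fin n
  project (inj₁ a) = a
  project (inj₂ b) = σ⁻¹ b

  -- Under `project` a `σ`-edge shrinks to a point and a `τ`-edge becomes one step of `relative`.
  edge-orbit : ∀ a b → F a b ≡ true → Orbit relative a (σ⁻¹ b)
  edge-orbit a b eq with union-true a b eq
  ... | inj₁ refl = 0 , sym (σ-inj (σσ⁻¹ (σ a)))
  ... | inj₂ refl = 1 , refl

  reachable⇒orbit : ∀ {u v} → Reachable F u v → Orbit relative (project u) (project v)
  reachable⇒orbit ε = orbit-refl
  reachable⇒orbit (_◅_ {inj₁ a} {inj₂ b} adj path) =
    orbit-trans (edge-orbit a b adj) (reachable⇒orbit path)
  reachable⇒orbit (_◅_ {inj₂ b} {inj₁ a} adj path) =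
    orbit-trans (R.orbit-sym (edge-orbit a b adj)) (reachable⇒orbit path)

  to-project : ∀ v → Reachable F v (inj₁ (project v))
  to-project (inj₁ a) = ε
  to-project (inj₂ b) = union-left (sym (σσ⁻¹ b)) ◅ ε

  from-project : ∀ v → Reachable F (inj₁ (project v)) v
  from-project (inj₁ a) = ε
  from-project (inj₂ b) = union-left (sym (σσ⁻¹ b)) ◅ ε

  orbit⇒reachable : ∀ {a a′} → Orbit relative a a′ → Reachable F (inj₁ a) (inj₁ a′)
  orbit⇒reachable = orbit-least {_~_ = λ a a′ → Reachable F (inj₁ a) (inj₁ a′)} ε _◅◅_
    (λ a → _◅_ {j = inj₂ (τ a)} (union-right refl) (to-project (inj₂ (τ a))))

  componentCount : ClassCount (Orbit relative) c → HasComponentCount F c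
  componentCount = classCount-resp project (λ a → inj₁ a , refl) λ u v →
    mk⇔ (λ orbit → to-project u ◅◅ orbit⇒reachable orbit ◅◅ from-project v) reachable⇒orbit

-- Splitting a 2-factor into two perfect matchings.

-- Stated for an ambient graph, so that the same record holds the splitting of a 2-factor, its image
-- in the larger graph, and the result of a switch.
record Decomposition (G : BipGraph n) : Set where
  field
    σ τ   : Fin n → Fin n
    σ-inj : Injective _≡_ _≡_ σ
    τ-inj : Injective _≡_ _≡_ τ
    Gσ    : ∀ a → G a (σ a) ≡ true
    Gτ    : ∀ a → G a (τ a) ≡ true
    σ≢τ   : ∀ a → σ a ≢ τ a

-- The matching selected by `s` is onto, so a common end of two unselected half-edges would carry a
-- selected one as well, three in all.
otherMatching : (h : Fin n × Bool → Fin n) → AtMostTwice h → (s : Fin n → Bool) →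
  Injective _≡_ _≡_ (λ a → h (a , s a)) → Injective _≡_ _≡_ (λ a → h (a , not (s a)))
otherMatching h twice s inj {a} {a′} eq
  with a″ , eq″ ← Permutation.surjective inj (h (a , not (s a)))
  with twice (a , not (s a)) (a′ , not (s a′)) (a″ , s a″) eq (sym eq″)
... | inj₁ e        = cong proj₁ e
... | inj₂ (inj₁ e) = contradiction (sym (cong proj₂ e))
                        (subst (λ z → s z ≢ not (s a)) (cong proj₁ e) (not-¬ refl))
... | inj₂ (inj₂ e) = contradiction (sym (cong proj₂ e))
                        (subst (λ z → s z ≢ not (s a′)) (cong proj₁ e) (not-¬ refl))

module _ (F : BipGraph n) (h : Fin n × Bool → Fin n)
  (h-edge : ∀ e → F (proj₁ e) (h e) ≡ true)
  (h-injective : ∀ a {s s′} → h (a , s) ≡ h (a , s′) → s ≡ s′)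
  (ends : ∀ b → ∃₂ λ i j → ∀ a → F a b ≡ true → a ≡ i ⊎ a ≡ j) where

  -- Three half-edges with a common end start at only two possible vertices. Two of them share their
  -- start, and then they agree by `h-injective`.
  halfEdges-twice : AtMostTwice h
  halfEdges-twice e₁ e₂ e₃ e₁~e₂ e₁~e₃ =
    let i , j , only = ends (h e₁) in cases i j
      (only (proj₁ e₁) (h-edge e₁))
      (only (proj₁ e₂) (subst (λ b → F (proj₁ e₂) b ≡ true) (sym e₁~e₂) (h-edge e₂)))
      (only (proj₁ e₃) (subst (λ b → F (proj₁ e₃) b ≡ true) (sym e₁~e₃) (h-edge e₃)))
    where
    same : ∀ {e e′ i} → h e ≡ h e′ → proj₁ e ≡ i → proj₁ e′ ≡ i → e ≡ e′
    same {a , _} eq refl refl = cong (a ,_) (h-injective a eq)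
    e₂~e₃ : h e₂ ≡ h e₃
    e₂~e₃ = trans (sym e₁~e₂) e₁~e₃
    cases : ∀ i j → proj₁ e₁ ≡ i ⊎ proj₁ e₁ ≡ j → proj₁ e₂ ≡ i ⊎ proj₁ e₂ ≡ j →
      proj₁ e₃ ≡ i ⊎ proj₁ e₃ ≡ j → e₁ ≡ e₂ ⊎ e₁ ≡ e₃ ⊎ e₂ ≡ e₃
    cases i j (inj₁ p) (inj₁ q) _        = inj₁ (same e₁~e₂ p q)
    cases i j (inj₂ p) (inj₂ q) _        = inj₁ (same e₁~e₂ p q)
    cases i j (inj₁ p) (inj₂ _) (inj₁ r) = inj₂ (inj₁ (same e₁~e₃ p r))
    cases i j (inj₂ p) (inj₁ _) (inj₂ r) = inj₂ (inj₁ (same e₁~e₃ p r))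
    cases i j (inj₁ _) (inj₂ q) (inj₂ r) = inj₂ (inj₂ (same e₂~e₃ q r))
    cases i j (inj₂ _) (inj₁ q) (inj₁ r) = inj₂ (inj₂ (same e₂~e₃ q r))

  decomposeHalfEdges : Decomposition F
  decomposeHalfEdges = let s , s-inj = perfectMatching h halfEdges-twice in record
    { σ     = λ a → h (a , not (s a))
    ; τ     = λ a → h (a , s a)
    ; σ-inj = otherMatching h halfEdges-twice s s-inj
    ; τ-inj = s-inj
    ; Gσ    = λ a → h-edge (a , not (s a))
    ; Gτ    = λ a → h-edge (a , s a)
    ; σ≢τ   = λ a eq → not-¬ {x = s a} refl (sym (h-injective a eq))
    }

decompose : {F : BipGraph n} → (∀ v → degree F v ≡ 2) → Decomposition F
decompose {n} {F} regular = decomposeHalfEdges F h h-edge h-injective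
  (λ b → let i , j , _ , _ , _ , only = pair (λ a → F a b) (regular (inj₂ b)) in i , j , only)
  where
  pair = λ (P : Fin n → Bool) (eq : countTrue (map P (allFin n)) ≡ 2) →
    count≡2⇒pair P (trans (sym (countTrue-allFin P)) eq)
  nbrs = λ a → pair (F a) (regular (inj₁ a))
  h : Fin n × Bool → Fin n
  h (a , false) = proj₁ (nbrs a)
  h (a , true)  = proj₁ (proj₂ (nbrs a))
  h-edge : ∀ e → F (proj₁ e) (h e) ≡ true
  h-edge (a , false) = let _ , _ , _ , edge , _ = nbrs a in edge
  h-edge (a , true)  = let _ , _ , _ , _ , edge , _ = nbrs a in edge
  h-injective : ∀ a {s s′} → h (a , s) ≡ h (a , s′) → s ≡ s′
  h-injective a {false} {false} eq = refl
  h-injective a {true}  {true}  eq = refl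
  h-injective a {false} {true}  eq = contradiction eq (proj₁ (proj₂ (proj₂ (nbrs a))))
  h-injective a {true}  {false} eq = contradiction (sym eq) (proj₁ (proj₂ (proj₂ (nbrs a))))

decomposition-mono : {F G : BipGraph n} → SubgraphOf F G → Decomposition F → Decomposition G
decomposition-mono F⊆G D = record
  { σ = σ ; τ = τ ; σ-inj = σ-inj ; τ-inj = τ-inj ; σ≢τ = σ≢τ
  ; Gσ = λ a → F⊆G a (σ a) (Gσ a) ; Gτ = λ a → F⊆G a (τ a) (Gτ a) }
  where open Decomposition D

-- Switching along an alternating cycle.

module _ {G : BipGraph n} (D : Decomposition G) where
  open Decomposition D

  switched-decomposition : {ρ f : Fin n → Fin n} → Injective _≡_ _≡_ ρ →
    (∀ a → ρ a ≡ a ⊎ ρ a ≡ f a) →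
    (∀ a → G a (τ (f a)) ≡ true) → (∀ a → σ a ≢ τ (f a)) → Decomposition G
  switched-decomposition {ρ} ρ-inj cases Gτf σ≢τf = record
    { σ = σ ; τ = τ ∘ ρ ; σ-inj = σ-inj ; τ-inj = ρ-inj ∘ τ-inj ; Gσ = Gσ ; Gτ = Gτ′ ; σ≢τ = σ≢τ′ }
    where
    Gτ′ : ∀ a → G a (τ (ρ a)) ≡ true
    Gτ′ a with cases a
    ... | inj₁ eq = trans (cong (G a ∘ τ) eq) (Gτ a)
    ... | inj₂ eq = trans (cong (G a ∘ τ) eq) (Gτf a)
    σ≢τ′ : ∀ a → σ a ≢ τ (ρ a)
    σ≢τ′ a σa≡ with cases a
    ... | inj₁ eq = σ≢τ a (trans σa≡ (cong τ eq))
    ... | inj₂ eq = σ≢τf a (trans σa≡ (cong τ eq))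

  private
    module U = Union σ-inj τ-inj

  noAlternatingSwitch : Pseudo2FactorIsomorphic G → Fin n →
    (f : Fin n → Fin n) (colour : Fin n → Bool) → (∀ a → colour (f a) ≡ not (colour a)) →
    (∀ a → G a (τ (f a)) ≡ true) → ¬ (∀ a → σ a ≢ τ (f a))
  noAlternatingSwitch (_ , parity) a₀ f colour alternates Gτf σ≢τf =
    let y , p , closes , distinct = simpleCycle f a₀ in switch y p closes distinct
    where
    switch : ∀ y p → fold y f (suc p) ≡ y →
      (∀ {i j} → i < j → j ≤ p → fold y f i ≢ fold y f j) → _
    switch y p closes distinct =
      let c₁ , count₁ = Permutation.orbitCount U.relative-injective
          -- The relative permutation of `σ` and `τ ∘ rotate p` is by definition
          -- `U.relative ∘ rotate p`, so `c₂` counts the cycles of the switched 2-factor.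
          c₂ , count₂ = Permutation.orbitCount (rotate-injective p ∘ U.relative-injective)
      -- Modulo 2, the rotation gives c₂ + p = c₁ and the hypothesis on the graph gives c₁ = c₂,
      -- whereas `p` is odd.
      in even+odd c₂ p even (trans (rotate-count U.relative-injective moves p count₁ count₂)
        (parity (union σ τ) (union σ (τ ∘ rotate p))
          (U.union-isTwoFactor Gσ Gτ σ≢τ)
          (Union.union-isTwoFactor σ-inj D′.τ-inj D′.Gσ D′.Gτ D′.σ≢τ)
          c₁ c₂ (U.componentCount count₁) (Union.componentCount σ-inj D′.τ-inj count₂)))
      where
      x : ℕ → Fin n
      x = fold y f
      open Rotation x
      module D′ = Decomposition (switched-decomposition (rotate-injective p)
        (rotate-cycle distinct (λ _ → refl) closes) Gτf σ≢τf)
      even : suc p % 2 ≡ 0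
      even = fold-not-even (colour y) (suc p)
        (trans (sym (fold-alternating colour alternates y (suc p))) (cong colour closes))
      moves : ∀ k → x k ≢ x (suc k)
      moves k eq = not-¬ refl (trans (cong colour eq) (alternates (x k)))

  alternatingSwitch : n < 2 ^ d → (∀ a → suc (suc d) ≤ degree G (inj₁ a)) →
    ∃₂ λ (f : Fin n → Fin n) (colour : Fin n → Bool) →
      (∀ a → colour (f a) ≡ not (colour a)) ×
      (∀ a → G a (τ (f a)) ≡ true × σ a ≢ τ (f a))
  alternatingSwitch {d} n<2^d large =
    let v , hits = twoColouring E E-large n<2^d
        -- Colours live on B and are pulled back along `τ`. The neighbour found for `a` is written
        -- as `τ (f a)`, so its having the colour opposite to `τ a` is alternation along `f`.
        colour   = λ a → lookup v (τ a)
        next     = λ a → hits a (colour a)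
        preimage = λ a → Permutation.surjective τ-inj (proj₁ (next a))
    in (λ a → proj₁ (preimage a)) , colour ,
       (λ a → trans (cong (lookup v) (proj₂ (preimage a))) (proj₂ (proj₂ (next a)))) ,
       (λ a → let edge , ≢σa = erase-true (G a) (σ a) (proj₁ (proj₂ (next a)))
                  eq = proj₂ (preimage a)
              in trans (cong (G a) eq) edge , λ σa≡ → ≢σa (sym (trans σa≡ eq)))
    where
    E : Fin n → Fin n → Bool
    E a = erase (σ a) (G a)
    -- Of at least d + 2 neighbours one is the partner `σ a`, which leaves d + 1.
    E-large : ∀ a → suc d ≤ count (E a)
    E-large a = ℕ.s≤s⁻¹ (subst (suc (suc d) ≤_)
      (trans (countTrue-allFin (G a)) (count-erase (G a) (σ a) (Gσ a))) (large a))

noLargeDegrees : {G : BipGraph n} → Pseudo2FactorIsomorphic G → Fin n → n < 2 ^ d →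
  ¬ (∀ a → suc (suc d) ≤ degree G (inj₁ a))
noLargeDegrees pseudo@((F , F⊆G , regular) , _) a₀ n<2^d large =
  let D = decomposition-mono F⊆G (decompose regular)
      f , colour , alternates , edges = alternatingSwitch D n<2^d large
  in noAlternatingSwitch D pseudo a₀ f colour alternates (proj₁ ∘ edges) (proj₂ ∘ edges)

-- The logarithmic bound.

-- Otherwise monotonicity of `⌊log₂_⌋` would put it one above its own value at `n`.
n<2^[1+⌊log₂n⌋] : ∀ n → n < 2 ^ suc ⌊log₂ n ⌋
n<2^[1+⌊log₂n⌋] n with n <? 2 ^ suc ⌊log₂ n ⌋
... | yes lt = lt
... | no  ≮  = contradiction
  (≤-trans (≤-reflexive (sym (⌊log₂[2^n]⌋≡n (suc ⌊log₂ n ⌋)))) (⌊log₂⌋-mono-≤ (≮⇒≥ ≮)))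
  (<-irrefl refl)

theorem2p5 : (n : ℕ) → .{{_ : NonZero n}} → (G : BipGraph n) → Pseudo2FactorIsomorphic G →
    ∃ λ (v : Vertex n) → degree G v ≤ ⌊log₂ n ⌋ + 2
theorem2p5 n G pseudo with any? (λ a → degree G (inj₁ a) ≤? ⌊log₂ n ⌋ + 2)
... | yes (a , small) = inj₁ a , small
... | no  none = contradiction large
        -- Since `n` is positive, A has a vertex from which the walk along `f` can start.
        (noLargeDegrees pseudo (fromℕ< (>-nonZero⁻¹ n)) (n<2^[1+⌊log₂n⌋] n))
  where
  -- With d = ⌊log₂ n⌋ + 1, exceeding ⌊log₂ n⌋ + 2 means having degree at least d + 2.
  large : ∀ a → 3 + ⌊log₂ n ⌋ ≤ degree G (inj₁ a)
  large a = subst (_< degree G (inj₁ a)) (+-comm ⌊log₂ n ⌋ 2) (≰⇒> (λ small → none (a , small)))
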